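{- Let $G$ be a finite connected simple graph with at least three vertices. If $G$ is a hairy graph, then $G$ is an SR-graph.
   Context: $\gamma(G)$ denotes the domination number of a finite simple graph $G$. For an edge $e=uv$ of $G$, $G-e$ is the graph obtained by deleting $e$, and $G_e$ is the graph obtained by subdividing $e$: delete $e$, add a new vertex $w$ and the edges $uw$ and $wv$. A finite connected simple graph $G$ of order at least two is an SR-graph (sub-removable graph) if $\gamma(G-e)=\gamma(G_e)$ for every edge $e$ of $G$. A leaf is a vertex of degree $1$; a support vertex is a vertex adjacent to a leaf. A graph is a hairy graph if each of its vertices is a leaf or a support vertex. -}

module Defs where

open import Data.Empty using (⊥)
open import Data.Fin.Base using (Fin; zero; suc)
open import Data.Fin.Properties using (_≟_; any?; all?)
open import Data.Fin.Subset using (Subset; ∣_∣; _∈_; ⊤)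
open import Data.Fin.Subset.Properties using (_∈?_; ∈⊤; anySubset?)
open import Data.Nat.Base using (ℕ; suc; _≤_; _<_)
open import Data.Nat.Induction using (Acc; acc; <-wellFounded)
open import Data.Nat.Properties using (_<?_; ≮⇒≥)
open import Data.Product.Base using (∃; _×_; _,_; proj₁)
open import Data.Sum.Base using (_⊎_; inj₁; inj₂)
open import Data.Vec.Base using (tabulate)
open import Level using (0ℓ)
open import Relation.Binary.Construct.Closure.ReflexiveTransitive using (Star)
open import Relation.Binary.Core using (Rel)
open import Relation.Binary.Definitions using (Decidable; Irreflexive; Symmetric)
open import Relation.Binary.PropositionalEquality using (_≡_; refl)
open import Relation.Nullary.Decidable using (Dec; yes; no; does; ¬?; _×-dec_; _⊎-dec_)
open import Relation.Nullary.Negation using (¬_)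
import Relation.Unary as U

record Graph (n : ℕ) : Set₁ where
  infix 4 _~_ _~?_
  field
    _~_      : Rel (Fin n) 0ℓ
    _~?_     : Decidable _~_
    ~-sym    : Symmetric _~_
    ~-irrefl : Irreflexive _≡_ _~_

record Edge {n : ℕ} (G : Graph n) : Set where
  open Graph G
  field
    source target : Fin n
    adjacent      : source ~ target

-- {x , y} and {u , v} are the same unordered pair.
SamePair : {A : Set} (u v x y : A) → Set
SamePair u v x y = (x ≡ u × y ≡ v) ⊎ (x ≡ v × y ≡ u)

samePair? : ∀ {n} (u v x y : Fin n) → Dec (SamePair u v x y)
samePair? u v x y = (x ≟ u ×-dec y ≟ v) ⊎-dec (x ≟ v ×-dec y ≟ u)

samePair-sym : ∀ {A : Set} {u v x y : A} → SamePair u v x y → SamePair u v y x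
samePair-sym (inj₁ (p , q)) = inj₂ (q , p)
samePair-sym (inj₂ (p , q)) = inj₁ (q , p)

infixl 6 _-ₑ_

_-ₑ_ : ∀ {n} (G : Graph n) → Edge G → Graph n
G -ₑ e = record
  { _~_      = λ x y → x ~ y × ¬ SamePair source target x y
  ; _~?_     = λ x y → (x ~? y) ×-dec ¬? (samePair? source target x y)
  ; ~-sym    = λ (x~y , ≢e) → ~-sym x~y , λ same → ≢e (samePair-sym same)
  ; ~-irrefl = λ x≡y (x~y , _) → ~-irrefl x≡y x~y
  }
  where
  open Graph G
  open Edge e

-- The new vertex is zero, and suc embeds the old vertices.
subdivide : ∀ {n} (G : Graph n) → Edge G → Graph (suc n)
subdivide {n} G e = record
  { _~_      = _~′_
  ; _~?_     = _~′?_
  ; ~-sym    = λ {x} {y} → sym′ x y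
  ; ~-irrefl = λ {x} {y} → irrefl′ x y
  }
  where
  open Graph (G -ₑ e)
  open Edge e

  _~′_ : Rel (Fin (suc n)) 0ℓ
  zero  ~′ zero  = ⊥
  zero  ~′ suc y = y ≡ source ⊎ y ≡ target
  suc x ~′ zero  = x ≡ source ⊎ x ≡ target
  suc x ~′ suc y = x ~ y

  _~′?_ : Decidable _~′_
  zero  ~′? zero  = no λ ()
  zero  ~′? suc y = (y ≟ source) ⊎-dec (y ≟ target)
  suc x ~′? zero  = (x ≟ source) ⊎-dec (x ≟ target)
  suc x ~′? suc y = x ~? y

  sym′ : ∀ x y → x ~′ y → y ~′ x
  sym′ zero    (suc y) p = p
  sym′ (suc x) zero    p = p
  sym′ (suc x) (suc y) p = ~-sym p

  irrefl′ : ∀ x y → x ≡ y → ¬ x ~′ y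
  irrefl′ (suc x) (suc .x) refl p = ~-irrefl refl p

module _ {n : ℕ} (G : Graph n) where
  open Graph G

  Connected : Set
  Connected = ∀ u v → Star _~_ u v

  neighbourhood : Fin n → Subset n
  neighbourhood v = tabulate λ u → does (v ~? u)

  degree : Fin n → ℕ
  degree v = ∣ neighbourhood v ∣

  Leaf : Fin n → Set
  Leaf v = degree v ≡ 1

  SupportVertex : Fin n → Set
  SupportVertex v = ∃ λ u → v ~ u × Leaf u

  Hairy : Set
  Hairy = ∀ v → Leaf v ⊎ SupportVertex v

  Dominating : Subset n → Set
  Dominating D = ∀ v → v ∈ D ⊎ ∃ λ u → u ∈ D × v ~ u

  dominating? : U.Decidable Dominating
  dominating? D =
    all? λ v → (v ∈? D) ⊎-dec any? λ u → (u ∈? D) ×-dec (v ~? u)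

  Minimum : Subset n → Set
  Minimum D = Dominating D × (∀ D′ → Dominating D′ → ∣ D ∣ ≤ ∣ D′ ∣)

  -- Repeatedly replace a dominating set by a smaller one.
  shrink : ∀ D → Dominating D → Acc _<_ ∣ D ∣ → ∃ Minimum
  shrink D dom (acc rs)
    with anySubset? (λ D′ → dominating? D′ ×-dec (∣ D′ ∣ <? ∣ D ∣))
  ... | yes (D′ , dom′ , D′<D) = shrink D′ dom′ (rs D′<D)
  ... | no  none = D , dom , λ D′ dom′ → ≮⇒≥ λ D′<D → none (D′ , dom′ , D′<D)

  minimumDominatingSet : ∃ Minimum
  minimumDominatingSet = shrink ⊤ (λ _ → inj₁ ∈⊤) (<-wellFounded _)

  γ : ℕ
  γ = ∣ proj₁ minimumDominatingSet ∣

record SR {n : ℕ} (G : Graph n) : Set where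
  field
    order≥2   : 2 ≤ n
    connected : Connected G
    removable : ∀ e → γ (G -ₑ e) ≡ γ (subdivide G e)

{-# OPTIONS --safe #-}
-- Lower bounds on γ come from packings: vertices with disjoint closed
-- neighbourhoods.  In a connected hairy graph of order at least three no two
-- leaves are adjacent.  If e joins two support vertices, then the support
-- vertices dominate both G - e and G_e, and choosing one leaf at each of them
-- gives a packing, so both numbers are the number of support vertices.  If
-- e = lu with l a leaf, let T be the set of vertices adjacent to a leaf other
-- than l.  Then T ∪ {l} dominates G - e (if u is not in T, it has a neighbour
-- other than l, which lies in T) and T ∪ {w} dominates G_e, while one leaf
-- other than l at each vertex of T, together with l, is a packing in both
-- graphs; so both numbers are |T| + 1.
module Submission where

open import Data.Bool.Base using (true)
open import Data.Fin.Base using (Fin; zero; suc; punchIn; punchOut)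
open import Data.Fin.Properties
  using (_≟_; any?; punchInᵢ≢i; punchIn-injective; punchIn-punchOut)
open import Data.Fin.Subset
  using (Subset; ∣_∣; _∈_; _⊆_; _∪_; ⁅_⁆; ⊥; inside; outside)
open import Data.Fin.Subset.Properties
  using (p⊆q⇒∣p∣≤∣q∣; x∈⁅x⁆; x∈p∪q⁺; q⊆p∪q; ∪-identityˡ; ∣⊥∣≡0;
         ∣p∣≤∣x∷p∣)
open import Data.Nat.Base using (ℕ; suc; _≤_; s≤s)
import Data.Nat.Properties as ℕ
open import Data.Product.Base using (∃; _×_; _,_; proj₁; proj₂)
open import Data.Sum.Base using (_⊎_; inj₁; inj₂; [_,_]; map; swap)
open import Data.Vec.Base using ([]; _∷_; here; there; tabulate)
open import Data.Vec.Properties using ([]=⇒lookup; lookup⇒[]=; lookup∘tabulate)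
open import Function.Base using (_∘_)
open import Level using (Level)
open import Relation.Binary.Construct.Closure.ReflexiveTransitive
  using (Star; ε; _◅_)
open import Relation.Binary.PropositionalEquality
  using (_≡_; _≢_; refl; sym; trans; cong; subst; subst₂; ≢-sym)
open import Relation.Nullary.Decidable
  using (Dec; yes; no; does; ¬?; _×-dec_; dec-true)
open import Relation.Nullary.Negation using (¬_; contradiction)
open import Relation.Unary using (Pred; Decidable)
open import Defs

private
  variable
    ℓ : Level
    m n k : ℕ

-- Finite subsets, images and cardinalities.

does-true : {A : Set ℓ} (a? : Dec A) → does a? ≡ true → A
does-true (yes a) _ = a

module _ {P : Pred (Fin n) ℓ} (P? : Decidable P) where

  comprehension : Subset n
  comprehension = tabulate (does ∘ P?)

  ∈-comprehension⁺ : ∀ {x} → P x → x ∈ comprehension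
  ∈-comprehension⁺ {x} px = lookup⇒[]= x _
    (trans (lookup∘tabulate (does ∘ P?) x) (dec-true (P? x) px))

  ∈-comprehension⁻ : ∀ {x} → x ∈ comprehension → P x
  ∈-comprehension⁻ {x} x∈ = does-true (P? x)
    (trans (sym (lookup∘tabulate (does ∘ P?) x)) ([]=⇒lookup x∈))

∣⁅x⁆∪p∣≤1+∣p∣ : ∀ (x : Fin n) p → ∣ ⁅ x ⁆ ∪ p ∣ ≤ suc ∣ p ∣
∣⁅x⁆∪p∣≤1+∣p∣ zero    (b ∷ p) rewrite ∪-identityˡ p = s≤s (∣p∣≤∣x∷p∣ b p)
∣⁅x⁆∪p∣≤1+∣p∣ (suc x) (outside ∷ p) = ∣⁅x⁆∪p∣≤1+∣p∣ x p
∣⁅x⁆∪p∣≤1+∣p∣ (suc x) (inside  ∷ p) = s≤s (∣⁅x⁆∪p∣≤1+∣p∣ x p)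

image : (Fin m → Fin k) → Subset m → Subset k
image f []            = ⊥
image f (outside ∷ p) = image (f ∘ suc) p
image f (inside  ∷ p) = ⁅ f zero ⁆ ∪ image (f ∘ suc) p

∈-image⁺ : ∀ (f : Fin m → Fin k) {x p} → x ∈ p → f x ∈ image f p
∈-image⁺ f {p = inside  ∷ p} here       = x∈p∪q⁺ (inj₁ (x∈⁅x⁆ (f zero)))
∈-image⁺ f {p = outside ∷ p} (there x∈) = ∈-image⁺ (f ∘ suc) x∈
∈-image⁺ f {p = inside  ∷ p} (there x∈) =
  q⊆p∪q ⁅ f zero ⁆ _ (∈-image⁺ (f ∘ suc) x∈)

∣image∣≤∣p∣ : ∀ (f : Fin m → Fin k) p → ∣ image f p ∣ ≤ ∣ p ∣
∣image∣≤∣p∣ {k = k} f []  = ℕ.≤-reflexive (∣⊥∣≡0 k)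
∣image∣≤∣p∣ f (outside ∷ p) = ∣image∣≤∣p∣ (f ∘ suc) p
∣image∣≤∣p∣ f (inside  ∷ p) = ℕ.≤-trans
  (∣⁅x⁆∪p∣≤1+∣p∣ (f zero) (image (f ∘ suc) p))
  (s≤s (∣image∣≤∣p∣ (f ∘ suc) p))

∣p∣≡0⇒x∉p : ∀ {p : Subset n} {x} → ∣ p ∣ ≡ 0 → ¬ x ∈ p
∣p∣≡0⇒x∉p {p = outside ∷ p} ∣p∣≡0 (there x∈p) = ∣p∣≡0⇒x∉p ∣p∣≡0 x∈p

∣p∣≡1⇒singleton : ∀ (p : Subset n) → ∣ p ∣ ≡ 1 →
                  ∃ λ x → x ∈ p × (∀ {y} → y ∈ p → y ≡ x)
∣p∣≡1⇒singleton (inside ∷ p) ∣p∣≡1 = zero , here , λ where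
  here        → refl
  (there y∈p) → contradiction y∈p (∣p∣≡0⇒x∉p (ℕ.suc-injective ∣p∣≡1))
∣p∣≡1⇒singleton (outside ∷ p) ∣p∣≡1 with ∣p∣≡1⇒singleton p ∣p∣≡1
... | x , x∈p , unique = suc x , there x∈p , λ where
  (there y∈p) → cong suc (unique y∈p)

third : 3 ≤ n → {a b : Fin n} → a ≢ b → ∃ λ c → c ≢ a × c ≢ b
third (s≤s (s≤s (s≤s _))) {a} {b} a≢b =
  -- `punchOut a≢b` is `b` seen in the set with `a` removed. Removing that too still leaves an
  -- element, as `3 ≤ n`.
  punchIn a c , punchInᵢ≢i a c , λ c≡b →
    punchInᵢ≢i (punchOut a≢b) zero
      (punchIn-injective a _ _ (trans c≡b (sym (punchIn-punchOut a≢b))))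
  where c = punchIn (punchOut a≢b) zero

-- Packings as lower bounds for domination.

module _ (H : Graph m) where
  open Graph H

  -- Since g is constant on the closed neighbourhood of the vertex chosen for
  -- c, the neighbourhoods for different c are disjoint.  The packing is
  -- indexed by a subset of another Fin k so that packings in G - e and G_e
  -- can share their index set.
  Packing : Subset k → (Fin m → Fin k) → Set
  Packing C g = ∀ {c} → c ∈ C → ∃ λ v → ∀ {x} → x ≡ v ⊎ v ~ x → g x ≡ c

  -- `D` meets the closed neighbourhood of each chosen vertex, where `g` takes the value `c`. So `C`
  -- lies in the image of `D` under `g`.
  packing≤dominating : ∀ {C : Subset k} {g D} →
                       Packing C g → Dominating H D → ∣ C ∣ ≤ ∣ D ∣
  packing≤dominating {C = C} {g} {D} packing dom =
    ℕ.≤-trans (p⊆q⇒∣p∣≤∣q∣ C⊆image) (∣image∣≤∣p∣ g D)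
    where
    C⊆image : C ⊆ image g D
    C⊆image c∈C with packing c∈C
    ... | v , const with dom v
    ... | inj₁ v∈D             =
      subst (_∈ image g D) (const (inj₁ refl)) (∈-image⁺ g v∈D)
    ... | inj₂ (u , u∈D , v~u) =
      subst (_∈ image g D) (const (inj₂ v~u)) (∈-image⁺ g u∈D)

  γ≡∣packing∣ : ∀ {C : Subset k} {g D} → Packing C g →
                Dominating H D → ∣ D ∣ ≤ ∣ C ∣ → γ H ≡ ∣ C ∣
  γ≡∣packing∣ {D = D} packing dom D≤C
    with minimumDominatingSet H
  ... | M , domM , min = ℕ.≤-antisym
    (ℕ.≤-trans (min D dom) D≤C)
    (packing≤dominating packing domM)

-- Leaves and their neighbours.

module Leaves (G : Graph n) where
  open Graph G

  leaf? : Decidable (Leaf G)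
  leaf? v = degree G v ℕ.≟ 1

  leaf-neighbour : ∀ {v} → Leaf G v → ∃ λ u → v ~ u × (∀ {x} → v ~ x → x ≡ u)
  leaf-neighbour {v} leaf with ∣p∣≡1⇒singleton (neighbourhood G v) leaf
  ... | u , u∈N , unique =
    u , ∈-comprehension⁻ (v ~?_) u∈N , unique ∘ ∈-comprehension⁺ (v ~?_)

  leaf-unique : ∀ {v x y} → Leaf G v → v ~ x → v ~ y → x ≡ y
  leaf-unique leaf v~x v~y with leaf-neighbour leaf
  ... | _ , _ , unique = trans (unique v~x) (sym (unique v~y))

  -- Fixing the non-leaves makes this constant on the closed neighbourhood of any leaf whose
  -- neighbour is not a leaf, as a packing requires.
  support : Fin n → Fin n
  support v with leaf? v
  ... | yes leaf = proj₁ (leaf-neighbour leaf)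
  ... | no  _    = v

  support-leaf : ∀ {v u} → Leaf G v → v ~ u → support v ≡ u
  support-leaf {v} leaf v~u with leaf? v
  ... | yes leaf′ = sym (proj₂ (proj₂ (leaf-neighbour leaf′)) v~u)
  ... | no  ¬leaf = contradiction leaf ¬leaf

  support-nonleaf : ∀ {v} → ¬ Leaf G v → support v ≡ v
  support-nonleaf {v} ¬leaf with leaf? v
  ... | yes leaf = contradiction leaf ¬leaf
  ... | no  _    = refl

-- Connected hairy graphs of order at least three.

module HairyGraph (G : Graph n) (connected : Connected G) (3≤n : 3 ≤ n)
                  (hairy : Hairy G) where
  open Graph G
  open Leaves G

  ~⇒≢ : ∀ {x y} → x ~ y → x ≢ y
  ~⇒≢ x~y x≡y = ~-irrefl x≡y x~y

  -- Otherwise {l , u} would be closed under adjacency.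
  other-neighbour : ∀ {l u} → Leaf G l → l ~ u → ∃ λ x → u ~ x × x ≢ l
  other-neighbour {l} {u} leaf l~u
    with any? (λ x → (u ~? x) ×-dec ¬? (x ≟ l))
  ... | yes found = found
  ... | no  none with third 3≤n (~⇒≢ l~u)
  ... | c , c≢l , c≢u =
    contradiction (closed (inj₁ refl) (connected l c)) [ c≢l , c≢u ]
    where
    closed : ∀ {x y} → x ≡ l ⊎ x ≡ u → Star _~_ x y → y ≡ l ⊎ y ≡ u
    closed x∈          ε                  = x∈
    closed (inj₁ refl) (l~y ◅ path)       = closed (inj₂ (leaf-unique leaf l~y l~u)) path
    closed (inj₂ refl) (_◅_ {j = y} u~y path) with y ≟ l
    ... | yes y≡l = closed (inj₁ y≡l) path
    ... | no  y≢l = contradiction (y , u~y , y≢l) none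

  leaf-neighbour-nonleaf : ∀ {l u} → Leaf G l → l ~ u → ¬ Leaf G u
  leaf-neighbour-nonleaf leafₗ l~u leafᵤ with other-neighbour leafₗ l~u
  ... | x , u~x , x≢l = x≢l (leaf-unique leafᵤ u~x (~-sym l~u))

  nonleaf⇒support : ∀ {v} → ¬ Leaf G v → SupportVertex G v
  nonleaf⇒support {v} ¬leaf with hairy v
  ... | inj₁ leaf = contradiction leaf ¬leaf
  ... | inj₂ supp = supp

  -- The closed neighbourhood is just `v` and `c`, and `c` is no leaf, so `support` fixes it.
  support-near-leaf : ∀ {c v} → Leaf G v → c ~ v →
                      ∀ {x} → x ≡ v ⊎ v ~ x → support x ≡ c
  support-near-leaf leaf c~v (inj₁ refl) = support-leaf leaf (~-sym c~v)
  support-near-leaf leaf c~v (inj₂ v~x)  = trans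
    (support-nonleaf (leaf-neighbour-nonleaf leaf v~x))
    (leaf-unique leaf v~x (~-sym c~v))

  module _ (e : Edge G) where
    open Edge e
    private
      module G₋ = Graph (G -ₑ e)
      module Gₑ = Graph (subdivide G e)

    Incident : Fin n → Set
    Incident x = x ≡ source ⊎ x ≡ target

    keep : ∀ {x y} → ¬ Incident x → x ~ y → x G₋.~ y
    keep ¬inc x~y = x~y , λ where
      (inj₁ (x≡s , _)) → ¬inc (inj₁ x≡s)
      (inj₂ (x≡t , _)) → ¬inc (inj₂ x≡t)

    -- Edges joining two non-leaves.

    module Internal (¬leafₛ : ¬ Leaf G source) (¬leafₜ : ¬ Leaf G target) where

      leaf⇒¬incident : ∀ {v} → Leaf G v → ¬ Incident v
      leaf⇒¬incident leaf (inj₁ refl) = ¬leafₛ leaf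
      leaf⇒¬incident leaf (inj₂ refl) = ¬leafₜ leaf

      support? : Decidable (SupportVertex G)
      support? v = any? λ x → (v ~? x) ×-dec leaf? x

      S : Subset n
      S = comprehension support?

      -- Non-leaves lie in `S` because `G` is hairy. Leaves are not ends of `e`, so they keep their
      -- edge to `S`.
      S-dominating : Dominating (G -ₑ e) S
      S-dominating v with leaf? v
      ... | no  ¬leaf = inj₁ (∈-comprehension⁺ support? (nonleaf⇒support ¬leaf))
      ... | yes leaf with leaf-neighbour leaf
      ... | u , v~u , _ =
        inj₂ (u , ∈-comprehension⁺ support? (v , ~-sym v~u , leaf)
                , keep (leaf⇒¬incident leaf) v~u)

      packing₋ : Packing (G -ₑ e) S support
      packing₋ c∈S with ∈-comprehension⁻ support? c∈S
      ... | v , c~v , leaf = v , λ where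
        (inj₁ x≡v)       → support-near-leaf leaf c~v (inj₁ x≡v)
        (inj₂ (v~x , _)) → support-near-leaf leaf c~v (inj₂ v~x)

      dominatingₑ : Dominating (subdivide G e) (outside ∷ S)
      -- The end `source` of `e` is no leaf, hence lies in `S` and dominates the new vertex.
      dominatingₑ zero = inj₂
        ( suc source
        , there (∈-comprehension⁺ support? (nonleaf⇒support ¬leafₛ))
        , inj₁ refl )
      dominatingₑ (suc v) with S-dominating v
      ... | inj₁ v∈S             = inj₁ (there v∈S)
      ... | inj₂ (u , u∈S , v~u) = inj₂ (suc u , there u∈S , v~u)

      -- The value at the new vertex is irrelevant: it is adjacent to no leaf.
      supportₑ : Fin (suc n) → Fin n
      supportₑ zero    = source
      supportₑ (suc v) = support v

      packingₑ : Packing (subdivide G e) S supportₑ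
      packingₑ {c} c∈S with ∈-comprehension⁻ support? c∈S
      ... | v , c~v , leaf = suc v , near
        where
        near : ∀ {x} → x ≡ suc v ⊎ suc v Gₑ.~ x → supportₑ x ≡ c
        near {zero}  (inj₂ inc)       = contradiction inc (leaf⇒¬incident leaf)
        near {suc x} (inj₁ refl)      = support-near-leaf leaf c~v (inj₁ refl)
        near {suc x} (inj₂ (v~x , _)) = support-near-leaf leaf c~v (inj₂ v~x)

      γ-equal : γ (G -ₑ e) ≡ γ (subdivide G e)
      γ-equal = trans
        (γ≡∣packing∣ (G -ₑ e) packing₋ S-dominating ℕ.≤-refl)
        (sym (γ≡∣packing∣ (subdivide G e) packingₑ dominatingₑ ℕ.≤-refl))

    -- Edges with a leaf as an end.

    module Pendant {l u} (same : SamePair source target l u) (leafₗ : Leaf G l)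
                   where

      l~u : l ~ u
      l~u = [ (λ (l≡s , u≡t) → subst₂ _~_ (sym l≡s) (sym u≡t) adjacent)
            , (λ (l≡t , u≡s) → subst₂ _~_ (sym l≡t) (sym u≡s) (~-sym adjacent))
            ] same

      incident-l : Incident l
      incident-l = [ inj₁ ∘ proj₁ , inj₂ ∘ proj₁ ] same

      incident⁻ : ∀ {x} → Incident x → x ≡ l ⊎ x ≡ u
      incident⁻ inc =
        [ (λ (l≡s , u≡t) → map (≡-via l≡s) (≡-via u≡t) inc)
        , (λ (l≡t , u≡s) → swap (map (≡-via u≡s) (≡-via l≡t) inc))
        ] same
        where
        ≡-via : ∀ {x y z : Fin n} → y ≡ z → x ≡ z → x ≡ y
        ≡-via y≡z x≡z = trans x≡z (sym y≡z)

      ¬leafᵤ : ¬ Leaf G u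
      ¬leafᵤ = leaf-neighbour-nonleaf leafₗ l~u

      ¬incident : ∀ {x} → x ≢ l → x ≢ u → ¬ Incident x
      ¬incident x≢l x≢u inc = [ x≢l , x≢u ] (incident⁻ inc)

      l-isolated : ∀ {x} → ¬ l G₋.~ x
      l-isolated (l~x , ¬same) with refl ← leaf-unique leafₗ l~x l~u = ¬same same

      -- Excluding `l` matters only at `u`, which counts only if some leaf remains attached to it
      -- once `e` is gone.
      HasOtherLeaf : Fin n → Set
      HasOtherLeaf v = ∃ λ x → v ~ x × Leaf G x × x ≢ l

      hasOtherLeaf? : Decidable HasOtherLeaf
      hasOtherLeaf? v = any? λ x → (v ~? x) ×-dec (leaf? x ×-dec ¬? (x ≟ l))

      T : Subset n
      T = comprehension hasOtherLeaf?

      -- The leaf at `v` cannot be `l`, whose only neighbour is `u`.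
      nonleaf∈T : ∀ {v} → ¬ Leaf G v → v ≢ u → v ∈ T
      nonleaf∈T ¬leaf v≢u with nonleaf⇒support ¬leaf
      ... | x , v~x , leaf = ∈-comprehension⁺ hasOtherLeaf?
        ( x , v~x , leaf
        , λ { refl → v≢u (leaf-unique leafₗ (~-sym v~x) l~u) } )

      T-dominates : ∀ v → v ≢ l → v ∈ T ⊎ ∃ λ x → x ∈ T × v G₋.~ x
      T-dominates v v≢l with leaf? v
      T-dominates v v≢l | yes leaf with leaf-neighbour leaf
      ... | x , v~x , _ =
        inj₂ ( x
             , ∈-comprehension⁺ hasOtherLeaf? (v , ~-sym v~x , leaf , v≢l)
             , keep (¬incident v≢l λ { refl → ¬leafᵤ leaf }) v~x )
      T-dominates v v≢l | no ¬leaf with v ≟ u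
      ... | no  v≢u  = inj₁ (nonleaf∈T ¬leaf v≢u)
      -- Any neighbour `x` of `u` other than `l` settles this case: a leaf `x` puts `u` into `T`,
      -- while a non-leaf `x` lies in `T` itself and stays adjacent to `u`.
      ... | yes refl with other-neighbour leafₗ l~u
      ... | x , u~x , x≢l with leaf? x
      ... | yes leaf = inj₁ (∈-comprehension⁺ hasOtherLeaf? (x , u~x , leaf , x≢l))
      ... | no ¬leafₓ =
        inj₂ ( x , nonleaf∈T ¬leafₓ (≢-sym (~⇒≢ u~x))
             , G₋.~-sym (keep (¬incident x≢l (≢-sym (~⇒≢ u~x))) (~-sym u~x)) )

      dominating₋ : Dominating (G -ₑ e) (⁅ l ⁆ ∪ T)
      dominating₋ v with v ≟ l
      ... | yes refl = inj₁ (x∈p∪q⁺ (inj₁ (x∈⁅x⁆ l)))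
      ... | no  v≢l with T-dominates v v≢l
      ... | inj₁ v∈T             = inj₁ (q⊆p∪q ⁅ l ⁆ T v∈T)
      ... | inj₂ (x , x∈T , v~x) = inj₂ (x , q⊆p∪q ⁅ l ⁆ T x∈T , v~x)

      -- The new vertex takes over the role of `l`: it dominates itself and `l`, and `T` dominates
      -- the rest as in `G -ₑ e`.
      dominatingₑ : Dominating (subdivide G e) (inside ∷ T)
      dominatingₑ zero = inj₁ here
      dominatingₑ (suc v) with v ≟ l
      ... | yes refl = inj₂ (zero , here , incident-l)
      ... | no  v≢l with T-dominates v v≢l
      ... | inj₁ v∈T             = inj₁ (there v∈T)
      ... | inj₂ (x , x∈T , v~x) = inj₂ (suc x , there x∈T , v~x)

      -- The index zero stands for the vertex l of the packing.
      index₋ : Fin n → Fin (suc n)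
      index₋ v with v ≟ l
      ... | yes _ = zero
      ... | no  _ = suc (support v)

      index₋-l : index₋ l ≡ zero
      index₋-l with l ≟ l
      ... | yes _   = refl
      ... | no  l≢l = contradiction refl l≢l

      index₋-other : ∀ {v} → v ≢ l → index₋ v ≡ suc (support v)
      index₋-other {v} v≢l with v ≟ l
      ... | yes v≡l = contradiction v≡l v≢l
      ... | no  _   = refl

      -- Leaves are never adjacent, so `l` is outside this closed neighbourhood and the index there
      -- comes from `support`.
      index₋-near : ∀ {c v} → c ~ v → Leaf G v → v ≢ l →
                    ∀ {x} → x ≡ v ⊎ v ~ x → index₋ x ≡ suc c
      index₋-near {v = v} c~v leaf v≢l {x} near = trans
        (index₋-other (x≢l near))
        (cong suc (support-near-leaf leaf c~v near))
        where
        x≢l : x ≡ v ⊎ v ~ x → x ≢ l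
        x≢l (inj₁ refl) = v≢l
        x≢l (inj₂ v~l) refl = leaf-neighbour-nonleaf leaf v~l leafₗ

      packing₋ : Packing (G -ₑ e) (inside ∷ T) index₋
      packing₋ here = l , λ where
        (inj₁ refl) → index₋-l
        (inj₂ l~x)  → contradiction l~x l-isolated
      packing₋ (there c∈T) with ∈-comprehension⁻ hasOtherLeaf? c∈T
      ... | v , c~v , leaf , v≢l = v , λ where
        (inj₁ x≡v)       → index₋-near c~v leaf v≢l (inj₁ x≡v)
        (inj₂ (v~x , _)) → index₋-near c~v leaf v≢l (inj₂ v~x)

      -- The new vertex is a neighbour of `l` in the subdivision, so both must share the index zero.
      indexₑ : Fin (suc n) → Fin (suc n)
      indexₑ zero    = zero
      indexₑ (suc v) = index₋ v

      packingₑ : Packing (subdivide G e) (inside ∷ T) indexₑ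
      packingₑ here = suc l , near
        where
        near : ∀ {x} → x ≡ suc l ⊎ suc l Gₑ.~ x → indexₑ x ≡ zero
        near {zero}  _           = refl
        near {suc x} (inj₁ refl) = index₋-l
        near {suc x} (inj₂ l~x)  = contradiction l~x l-isolated
      packingₑ {suc c} (there c∈T) with ∈-comprehension⁻ hasOtherLeaf? c∈T
      ... | v , c~v , leaf , v≢l = suc v , near
        where
        near : ∀ {x} → x ≡ suc v ⊎ suc v Gₑ.~ x → indexₑ x ≡ suc c
        -- The leaf `v` is neither `l` nor the non-leaf `u`, so it is not adjacent to the new
        -- vertex.
        near {zero}  (inj₂ inc) =
          contradiction inc (¬incident v≢l λ { refl → ¬leafᵤ leaf })
        near {suc x} (inj₁ refl)      = index₋-near c~v leaf v≢l (inj₁ refl)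
        near {suc x} (inj₂ (v~x , _)) = index₋-near c~v leaf v≢l (inj₂ v~x)

      γ-equal : γ (G -ₑ e) ≡ γ (subdivide G e)
      γ-equal = trans
        (γ≡∣packing∣ (G -ₑ e) packing₋ dominating₋ (∣⁅x⁆∪p∣≤1+∣p∣ l T))
        (sym (γ≡∣packing∣ (subdivide G e) packingₑ dominatingₑ ℕ.≤-refl))

    γ-removable : γ (G -ₑ e) ≡ γ (subdivide G e)
    γ-removable with leaf? source | leaf? target
    -- The choice of `inj₁` or `inj₂` decides which end of `e` plays the leaf `l`.
    ... | yes leafₛ | _         = Pendant.γ-equal (inj₁ (refl , refl)) leafₛ
    ... | no  _     | yes leafₜ = Pendant.γ-equal (inj₂ (refl , refl)) leafₜ
    ... | no ¬leafₛ | no ¬leafₜ = Internal.γ-equal ¬leafₛ ¬leafₜ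

theorem5 : (n : ℕ) (G : Graph n) → Connected G → 3 ≤ n → Hairy G → SR G
theorem5 n G connected 3≤n hairy = record
  { order≥2   = ℕ.≤-trans (ℕ.n≤1+n 2) 3≤n
  ; connected = connected
  ; removable = HairyGraph.γ-removable G connected 3≤n hairy
  }
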